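{- (a) VES $\cong$ VFS: the maps $\Psi$ (VES$\to$VFS) and $\Theta$ (VFS$\to$VES) are mutually inverse bijections, i.e. $\Theta(\Psi(M))=M$ and $\Theta(\Psi_v(V))=V$ for all VES-terms $M$ and values $V$, and $\Psi(\Theta(M))=M$ and $\Psi_v(\Theta_v(V))=V$ for all VFS-terms $M$ and values $V$ (up to $\alpha$-equivalence); they simulate reduction one step for one step: if $M_1\to M_2$ in VES then $\Psi(M_1)\to\Psi(M_2)$ in VFS, and if $M_1\to M_2$ in VFS then $\Theta(M_1)\to\Theta(M_2)$ in VES; and they preserve typing: for every VES-term $M$, context $\Gamma$ and type $A$, $\Gamma\vdash_{C}M:A$ iff $\Gamma\Rightarrow\Psi(M):A$. (b) CES $\cong$ CNF: the maps $\Upsilon$ (CES$\to$CNF) and $\Phi$ (CNF$\to$CES) are mutually inverse bijections on terms and on values; if $M_1\to M_2$ in CES then $\Upsilon(M_1)\to\Upsilon(M_2)$ in CNF, and if $M_1\to M_2$ in CNF then $\Phi(M_1)\to\Phi(M_2)$ in CES; and for every CES-term $M$, $\Gamma\vdash_{C}M:A$ iff $\Gamma\vdash_{J}\Upsilon(M):A$.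
   Context: Terms are identified up to $\alpha$-equivalence; substitution is capture-avoiding; one-step reduction $\to$ is the closure of the listed rules under all syntactic constructors. Simple types $A,B,C::=a\mid A\supset B$; a context $\Gamma$ is a set of declarations $x:A$ with no variable declared twice. Typing $\vdash_C$ of $\lambda C$-terms (terms built from variables, $\lambda x.M$, $MN$, $\mathsf{let}\,x:=M\,\mathsf{in}\,N$): $\Gamma,x:A\vdash_C x:A$; from $\Gamma,x:A\vdash_C M:B$ infer $\Gamma\vdash_C\lambda x.M:A\supset B$; from $\Gamma\vdash_C M:A\supset B$ and $\Gamma\vdash_C N:A$ infer $\Gamma\vdash_C MN:B$; from $\Gamma\vdash_C M:A$ and $\Gamma,x:A\vdash_C N:B$ infer $\Gamma\vdash_C\mathsf{let}\,x:=M\,\mathsf{in}\,N:B$. VES (a fragment of $\lambda C$): terms $M,N::=V\mid \mathsf{let}\,x:=V\,\mathsf{in}\,c_x$; for each variable $x$, $c_x::=M\mid \mathsf{let}\,y:=xW\,\mathsf{in}\,N$ with $x\notin FV(W)\cup FV(N)$; values $V,W::=x\mid\lambda x.M$. Derived operation $\mathsf{LET}$: $\mathsf{LET}\,y:=V\,\mathsf{in}\,P=\mathsf{let}\,y:=V\,\mathsf{in}\,P$; $\mathsf{LET}\,y:=(\mathsf{let}\,z:=V\,\mathsf{in}\,c_z)\,\mathsf{in}\,P=\mathsf{let}\,z:=V\,\mathsf{in}\,(\mathsf{LET}\,y:=c_z\,\mathsf{in}\,P)$; $\mathsf{LET}\,y:=(\mathsf{let}\,x:=zW\,\mathsf{in}\,N)\,\mathsf{in}\,P=\mathsf{let}\,x:=zW\,\mathsf{in}\,(\mathsf{LET}\,y:=N\,\mathsf{in}\,P)$.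 Rules: $(B_v)$ $\mathsf{let}\,y:=\lambda x.M\,\mathsf{in}\,(\mathsf{let}\,z:=yV\,\mathsf{in}\,P)\to\mathsf{let}\,x:=V\,\mathsf{in}\,(\mathsf{LET}\,z:=M\,\mathsf{in}\,P)$; $(\mathit{let}_v)$ $\mathsf{let}\,y:=V\,\mathsf{in}\,N\to[V/y]N$ ($N$ a VES-term). VFS: terms $M,N::=\uparrow V\mid \mathsf{C}_v(V,c)$; values $V,W::=x\mid\lambda x.M$; formal contexts $c::= x.M\mid (W,x.M)$ ($x$ bound in $M$). $(\uparrow V:c')=\mathsf{C}_v(V,c')$; $(\mathsf{C}_v(V,c):c')=\mathsf{C}_v(V,(c:c'))$; $((x.M):c')=x.(M:c')$; $((W,x.M):c')=(W,x.(M:c'))$. Rules: $(B_v)$ $\mathsf{C}_v(\lambda x.M,(V,y.N))\to\mathsf{C}_v(V,x.(M:y.N))$; $(\sigma_v)$ $\mathsf{C}_v(V,y.N)\to[V/y]N$. Typing (sequents $\Gamma\to V:A$, $\Gamma\Rightarrow M:A$, $\Gamma|A\Rightarrow c:B$): $\Gamma,x:A\to x:A$; from $\Gamma\to V:A$ infer $\Gamma\Rightarrow\uparrow V:A$; from $\Gamma,x:A\Rightarrow M:B$ infer $\Gamma\to\lambda x.M:A\supset B$; from $\Gamma\to V:A$ and $\Gamma|A\Rightarrow c:B$ infer $\Gamma\Rightarrow\mathsf{C}_v(V,c):B$; from $\Gamma,x:A\Rightarrow M:B$ infer $\Gamma|A\Rightarrow x.M:B$; from $\Gamma\to W:A$ and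 $\Gamma,x:B\Rightarrow M:C$ infer $\Gamma|A\supset B\Rightarrow(W,x.M):C$. Maps: $\Psi(V)=\uparrow\Psi_v(V)$; $\Psi(\mathsf{let}\,x:=V\,\mathsf{in}\,c_x)=\mathsf{C}_v(\Psi_vV,\Psi_x(c_x))$; $\Psi_v(x)=x$; $\Psi_v(\lambda x.M)=\lambda x.\Psi M$; $\Psi_x(M)=x.\Psi M$; $\Psi_x(\mathsf{let}\,y:=xW\,\mathsf{in}\,N)=(\Psi_vW,y.\Psi N)$. $\Theta(\uparrow V)=\Theta_v(V)$; $\Theta(\mathsf{C}_v(V,c))=\mathsf{let}\,x:=\Theta_vV\,\mathsf{in}\,\Theta_x(c)$ ($x$ fresh); $\Theta_v(x)=x$; $\Theta_v(\lambda x.M)=\lambda x.\Theta M$; $\Theta_x(y.M)=[x/y](\Theta M)$; $\Theta_x((W,y.N))=\mathsf{let}\,y:=x(\Theta_vW)\,\mathsf{in}\,\Theta N$. CES (a fragment of $\lambda C$): terms $M::=V\mid\mathsf{let}\,x:=VW\,\mathsf{in}\,M$; values $V,W::=x\mid\lambda x.M$. $\mathsf{LET}\,y:=V\,\mathsf{in}\,P=[V/y]P$; $\mathsf{LET}\,y:=(\mathsf{let}\,x:=VW\,\mathsf{in}\,M)\,\mathsf{in}\,P=\mathsf{let}\,x:=VW\,\mathsf{in}\,(\mathsf{LET}\,y:=M\,\mathsf{in}\,P)$. Rule $(\beta_v)$ $\mathsf{let}\,y:=(\lambda x.M)V\,\mathsf{in}\,P\to\mathsf{LET}\,y:=[V/x]M\,\mathsf{in}\,P$.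 CNF: terms $M::=V\mid V(W,x.M)$ ($x$ bound in $M$); values $V,W::=x\mid\lambda x.M$. Left substitution: $[V\backslash x]P=[V/x]P$; $[V(W,y.N)\backslash x]P=V(W,y.[N\backslash x]P)$. Rule $(\beta_v)$ $(\lambda y.M)(W,x.P)\to[[W/y]M\backslash x]P$. Typing $\vdash_J$: $\Gamma,x:A\vdash_J x:A$; from $\Gamma,x:A\vdash_J M:B$ infer $\Gamma\vdash_J\lambda x.M:A\supset B$; from $\Gamma\vdash_J V:A\supset B$, $\Gamma\vdash_J W:A$, $\Gamma,x:B\vdash_J M:C$ infer $\Gamma\vdash_J V(W,x.M):C$. Maps: $\Upsilon(x)=x$; $\Upsilon(\lambda x.M)=\lambda x.\Upsilon M$; $\Upsilon(\mathsf{let}\,x:=VW\,\mathsf{in}\,M)=\Upsilon V(\Upsilon W,x.\Upsilon M)$; $\Phi(x)=x$; $\Phi(\lambda x.M)=\lambda x.\Phi M$; $\Phi(V(W,x.M))=\mathsf{let}\,x:=\Phi V\,\Phi W\,\mathsf{in}\,\Phi M$. -}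

module Defs where

-- Conventions: all calculi use well-scoped de Bruijn syntax (a term of type
-- `Tm n` has its free variables among `Fin n`; index `zero` is the most
-- recently bound variable).  Hence terms are identified up to alpha-equivalence
-- by construction, and substitution is capture-avoiding by construction.

open import Data.Nat using (ℕ; zero; suc)
open import Data.Fin using (Fin; zero; suc)
open import Data.Vec using (Vec; []; _∷_; lookup)

infixr 5 _⊃_
data Ty : Set where
  atom : ℕ → Ty
  _⊃_  : Ty → Ty → Ty

Cxt : ℕ → Set
Cxt n = Vec Ty n

Ren : ℕ → ℕ → Set
Ren n m = Fin n → Fin m

ext : ∀ {n m} → Ren n m → Ren (suc n) (suc m)
ext ρ zero    = zero
ext ρ (suc i) = suc (ρ i)

module LC where
  data Tm (n : ℕ) : Set where
    var  : Fin n → Tm n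
    lam  : Tm (suc n) → Tm n
    app  : Tm n → Tm n → Tm n
    lett : Tm n → Tm (suc n) → Tm n

  ren : ∀ {n m} → Ren n m → Tm n → Tm m
  ren ρ (var i)    = var (ρ i)
  ren ρ (lam M)    = lam (ren (ext ρ) M)
  ren ρ (app M N)  = app (ren ρ M) (ren ρ N)
  ren ρ (lett M N) = lett (ren ρ M) (ren (ext ρ) N)

  infix 4 _⊢C_∶_
  data _⊢C_∶_ : ∀ {n} → Cxt n → Tm n → Ty → Set where
    var  : ∀ {n} {Γ : Cxt n} (i : Fin n) → Γ ⊢C var i ∶ lookup Γ i
    lam  : ∀ {n} {Γ : Cxt n} {A B M} → (A ∷ Γ) ⊢C M ∶ B → Γ ⊢C lam M ∶ A ⊃ B
    app  : ∀ {n} {Γ : Cxt n} {A B M N} →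
           Γ ⊢C M ∶ A ⊃ B → Γ ⊢C N ∶ A → Γ ⊢C app M N ∶ B
    lett : ∀ {n} {Γ : Cxt n} {A B M N} →
           Γ ⊢C M ∶ A → (A ∷ Γ) ⊢C N ∶ B → Γ ⊢C lett M N ∶ B

module VES where
  mutual
    data Tm (n : ℕ) : Set where
      val  : Val n → Tm n
      lett : Val n → Cx n → Tm n
    -- c_x for the variable x bound by the enclosing let (x is index zero):
    --   c_x ::= M                       (tm M, M : Tm (suc n), x may occur)
    --        |  let y := x W in N       (letapp W N; W : Val n and N : Tm (suc n)
    --                                    with y = index zero; x ∉ FV(W) ∪ FV(N)
    --                                    is enforced by scoping)
    data Cx (n : ℕ) : Set where
      tm     : Tm (suc n) → Cx n
      letapp : Val n → Tm (suc n) → Cx n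
    data Val (n : ℕ) : Set where
      var : Fin n → Val n
      lam : Tm (suc n) → Val n

  mutual
    ren : ∀ {n m} → Ren n m → Tm n → Tm m
    ren ρ (val V)    = val (renV ρ V)
    ren ρ (lett V c) = lett (renV ρ V) (renC ρ c)

    renC : ∀ {n m} → Ren n m → Cx n → Cx m
    renC ρ (tm M)       = tm (ren (ext ρ) M)
    renC ρ (letapp W N) = letapp (renV ρ W) (ren (ext ρ) N)

    renV : ∀ {n m} → Ren n m → Val n → Val m
    renV ρ (var i) = var (ρ i)
    renV ρ (lam M) = lam (ren (ext ρ) M)

  exts : ∀ {n m} → (Fin n → Val m) → Fin (suc n) → Val (suc m)
  exts σ zero    = var zero
  exts σ (suc i) = renV suc (σ i)

  mutual
    sub : ∀ {n m} → (Fin n → Val m) → Tm n → Tm m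
    sub σ (val V)    = val (subV σ V)
    sub σ (lett V c) = lett (subV σ V) (subC σ c)

    subC : ∀ {n m} → (Fin n → Val m) → Cx n → Cx m
    subC σ (tm M)       = tm (sub (exts σ) M)
    subC σ (letapp W N) = letapp (subV σ W) (sub (exts σ) N)

    subV : ∀ {n m} → (Fin n → Val m) → Val n → Val m
    subV σ (var i) = σ i
    subV σ (lam M) = lam (sub (exts σ) M)

  sub1 : ∀ {n} → Val n → Fin (suc n) → Val n
  sub1 V zero    = V
  sub1 V (suc i) = var i

  _[_] : ∀ {n} → Tm (suc n) → Val n → Tm n
  N [ V ] = sub (sub1 V) N

  mutual
    ⌜_⌝ : ∀ {n} → Tm n → LC.Tm n
    ⌜ val V ⌝    = ⌜ V ⌝v
    ⌜ lett V c ⌝ = LC.lett ⌜ V ⌝v ⌜ c ⌝c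

    ⌜_⌝c : ∀ {n} → Cx n → LC.Tm (suc n)
    ⌜ tm M ⌝c       = ⌜ M ⌝
    ⌜ letapp W N ⌝c = LC.lett (LC.app (LC.var zero) (LC.ren suc ⌜ W ⌝v))
                              (LC.ren (ext suc) ⌜ N ⌝)

    ⌜_⌝v : ∀ {n} → Val n → LC.Tm n
    ⌜ var i ⌝v = LC.var i
    ⌜ lam M ⌝v = LC.lam ⌜ M ⌝

  mutual
    LET : ∀ {n} → Tm n → Tm (suc n) → Tm n
    LET (val V)    P = lett V (tm P)
    LET (lett V c) P = lett V (LETc c P)

    LETc : ∀ {n} → Cx n → Tm (suc n) → Cx n
    LETc (tm M)       P = tm (LET M (ren (ext suc) P))
    LETc (letapp W N) P = letapp W (LET N (ren (ext suc) P))

  infix 4 _⟶_ _⟶c_ _⟶v_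
  mutual
    data _⟶_ : ∀ {n} → Tm n → Tm n → Set where
      Bv    : ∀ {n} {M : Tm (suc n)} {V : Val n} {P : Tm (suc n)} →
              lett (lam M) (letapp V P) ⟶ lett V (tm (LET M (ren (ext suc) P)))
      letv  : ∀ {n} {V : Val n} {N : Tm (suc n)} →
              lett V (tm N) ⟶ N [ V ]
      ξval  : ∀ {n} {V V' : Val n} → V ⟶v V' → val V ⟶ val V'
      ξlet₁ : ∀ {n} {V V' : Val n} {c : Cx n} → V ⟶v V' → lett V c ⟶ lett V' c
      ξlet₂ : ∀ {n} {V : Val n} {c c' : Cx n} → c ⟶c c' → lett V c ⟶ lett V c'

    data _⟶c_ : ∀ {n} → Cx n → Cx n → Set where
      ξtm  : ∀ {n} {M M' : Tm (suc n)} → M ⟶ M' → tm M ⟶c tm M'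
      ξla₁ : ∀ {n} {W W' : Val n} {N : Tm (suc n)} → W ⟶v W' → letapp W N ⟶c letapp W' N
      ξla₂ : ∀ {n} {W : Val n} {N N' : Tm (suc n)} → N ⟶ N' → letapp W N ⟶c letapp W N'

    data _⟶v_ : ∀ {n} → Val n → Val n → Set where
      ξlam : ∀ {n} {M M' : Tm (suc n)} → M ⟶ M' → lam M ⟶v lam M'

module VFS where
  mutual
    data Tm (n : ℕ) : Set where
      up : Val n → Tm n
      cv : Val n → Cx n → Tm n
    data Cx (n : ℕ) : Set where
      abs  : Tm (suc n) → Cx n
      pair : Val n → Tm (suc n) → Cx n
    data Val (n : ℕ) : Set where
      var : Fin n → Val n
      lam : Tm (suc n) → Val n

  mutual
    ren : ∀ {n m} → Ren n m → Tm n → Tm m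
    ren ρ (up V)   = up (renV ρ V)
    ren ρ (cv V c) = cv (renV ρ V) (renC ρ c)

    renC : ∀ {n m} → Ren n m → Cx n → Cx m
    renC ρ (abs M)    = abs (ren (ext ρ) M)
    renC ρ (pair W M) = pair (renV ρ W) (ren (ext ρ) M)

    renV : ∀ {n m} → Ren n m → Val n → Val m
    renV ρ (var i) = var (ρ i)
    renV ρ (lam M) = lam (ren (ext ρ) M)

  exts : ∀ {n m} → (Fin n → Val m) → Fin (suc n) → Val (suc m)
  exts σ zero    = var zero
  exts σ (suc i) = renV suc (σ i)

  mutual
    sub : ∀ {n m} → (Fin n → Val m) → Tm n → Tm m
    sub σ (up V)   = up (subV σ V)
    sub σ (cv V c) = cv (subV σ V) (subC σ c)

    subC : ∀ {n m} → (Fin n → Val m) → Cx n → Cx m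
    subC σ (abs M)    = abs (sub (exts σ) M)
    subC σ (pair W M) = pair (subV σ W) (sub (exts σ) M)

    subV : ∀ {n m} → (Fin n → Val m) → Val n → Val m
    subV σ (var i) = σ i
    subV σ (lam M) = lam (sub (exts σ) M)

  sub1 : ∀ {n} → Val n → Fin (suc n) → Val n
  sub1 V zero    = V
  sub1 V (suc i) = var i

  _[_] : ∀ {n} → Tm (suc n) → Val n → Tm n
  N [ V ] = sub (sub1 V) N

  infixl 5 _⦂_ _⦂c_
  mutual
    _⦂_ : ∀ {n} → Tm n → Cx n → Tm n
    up V   ⦂ c' = cv V c'
    cv V c ⦂ c' = cv V (c ⦂c c')

    _⦂c_ : ∀ {n} → Cx n → Cx n → Cx n
    abs M    ⦂c c' = abs (M ⦂ renC suc c')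
    pair W M ⦂c c' = pair W (M ⦂ renC suc c')

  infix 4 _⟶_ _⟶c_ _⟶v_
  mutual
    data _⟶_ : ∀ {n} → Tm n → Tm n → Set where
      Bv   : ∀ {n} {M : Tm (suc n)} {V : Val n} {N : Tm (suc n)} →
             cv (lam M) (pair V N) ⟶ cv V (abs (M ⦂ abs (ren (ext suc) N)))
      σv   : ∀ {n} {V : Val n} {N : Tm (suc n)} →
             cv V (abs N) ⟶ N [ V ]
      ξup  : ∀ {n} {V V' : Val n} → V ⟶v V' → up V ⟶ up V'
      ξcv₁ : ∀ {n} {V V' : Val n} {c : Cx n} → V ⟶v V' → cv V c ⟶ cv V' c
      ξcv₂ : ∀ {n} {V : Val n} {c c' : Cx n} → c ⟶c c' → cv V c ⟶ cv V c'

    data _⟶c_ : ∀ {n} → Cx n → Cx n → Set where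
      ξabs  : ∀ {n} {M M' : Tm (suc n)} → M ⟶ M' → abs M ⟶c abs M'
      ξpair₁ : ∀ {n} {W W' : Val n} {M : Tm (suc n)} → W ⟶v W' → pair W M ⟶c pair W' M
      ξpair₂ : ∀ {n} {W : Val n} {M M' : Tm (suc n)} → M ⟶ M' → pair W M ⟶c pair W M'

    data _⟶v_ : ∀ {n} → Val n → Val n → Set where
      ξlam : ∀ {n} {M M' : Tm (suc n)} → M ⟶ M' → lam M ⟶v lam M'

  infix 4 _⊢v_∶_ _⇒_∶_ _∣_⇒c_∶_
  mutual
    data _⊢v_∶_ : ∀ {n} → Cxt n → Val n → Ty → Set where
      var : ∀ {n} {Γ : Cxt n} (i : Fin n) → Γ ⊢v var i ∶ lookup Γ i
      lam : ∀ {n} {Γ : Cxt n} {A B M} → (A ∷ Γ) ⇒ M ∶ B → Γ ⊢v lam M ∶ A ⊃ B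

    data _⇒_∶_ : ∀ {n} → Cxt n → Tm n → Ty → Set where
      up : ∀ {n} {Γ : Cxt n} {A V} → Γ ⊢v V ∶ A → Γ ⇒ up V ∶ A
      cv : ∀ {n} {Γ : Cxt n} {A B V c} →
           Γ ⊢v V ∶ A → Γ ∣ A ⇒c c ∶ B → Γ ⇒ cv V c ∶ B

    data _∣_⇒c_∶_ : ∀ {n} → Cxt n → Ty → Cx n → Ty → Set where
      abs  : ∀ {n} {Γ : Cxt n} {A B M} → (A ∷ Γ) ⇒ M ∶ B → Γ ∣ A ⇒c abs M ∶ B
      pair : ∀ {n} {Γ : Cxt n} {A B C W M} →
             Γ ⊢v W ∶ A → (B ∷ Γ) ⇒ M ∶ C → Γ ∣ A ⊃ B ⇒c pair W M ∶ C

mutual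
  Ψ : ∀ {n} → VES.Tm n → VFS.Tm n
  Ψ (VES.val V)    = VFS.up (Ψv V)
  Ψ (VES.lett V c) = VFS.cv (Ψv V) (Ψx c)

  Ψv : ∀ {n} → VES.Val n → VFS.Val n
  Ψv (VES.var i) = VFS.var i
  Ψv (VES.lam M) = VFS.lam (Ψ M)

  Ψx : ∀ {n} → VES.Cx n → VFS.Cx n
  Ψx (VES.tm M)       = VFS.abs (Ψ M)
  Ψx (VES.letapp W N) = VFS.pair (Ψv W) (Ψ N)

mutual
  Θ : ∀ {n} → VFS.Tm n → VES.Tm n
  Θ (VFS.up V)   = VES.val (Θv V)
  Θ (VFS.cv V c) = VES.lett (Θv V) (Θx c)

  Θv : ∀ {n} → VFS.Val n → VES.Val n
  Θv (VFS.var i) = VES.var i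
  Θv (VFS.lam M) = VES.lam (Θ M)

  -- Θx(y.M) = [x/y](Θ M) : in de Bruijn form the renaming of y to the fresh x is
  -- the identity (both are index zero)
  Θx : ∀ {n} → VFS.Cx n → VES.Cx n
  Θx (VFS.abs M)    = VES.tm (Θ M)
  Θx (VFS.pair W N) = VES.letapp (Θv W) (Θ N)

module CES where
  mutual
    data Tm (n : ℕ) : Set where
      val  : Val n → Tm n
      lett : Val n → Val n → Tm (suc n) → Tm n
    data Val (n : ℕ) : Set where
      var : Fin n → Val n
      lam : Tm (suc n) → Val n

  mutual
    ren : ∀ {n m} → Ren n m → Tm n → Tm m
    ren ρ (val V)      = val (renV ρ V)
    ren ρ (lett V W M) = lett (renV ρ V) (renV ρ W) (ren (ext ρ) M)

    renV : ∀ {n m} → Ren n m → Val n → Val m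
    renV ρ (var i) = var (ρ i)
    renV ρ (lam M) = lam (ren (ext ρ) M)

  exts : ∀ {n m} → (Fin n → Val m) → Fin (suc n) → Val (suc m)
  exts σ zero    = var zero
  exts σ (suc i) = renV suc (σ i)

  mutual
    sub : ∀ {n m} → (Fin n → Val m) → Tm n → Tm m
    sub σ (val V)      = val (subV σ V)
    sub σ (lett V W M) = lett (subV σ V) (subV σ W) (sub (exts σ) M)

    subV : ∀ {n m} → (Fin n → Val m) → Val n → Val m
    subV σ (var i) = σ i
    subV σ (lam M) = lam (sub (exts σ) M)

  sub1 : ∀ {n} → Val n → Fin (suc n) → Val n
  sub1 V zero    = V
  sub1 V (suc i) = var i

  _[_] : ∀ {n} → Tm (suc n) → Val n → Tm n
  N [ V ] = sub (sub1 V) N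

  mutual
    ⌜_⌝ : ∀ {n} → Tm n → LC.Tm n
    ⌜ val V ⌝      = ⌜ V ⌝v
    ⌜ lett V W M ⌝ = LC.lett (LC.app ⌜ V ⌝v ⌜ W ⌝v) ⌜ M ⌝

    ⌜_⌝v : ∀ {n} → Val n → LC.Tm n
    ⌜ var i ⌝v = LC.var i
    ⌜ lam M ⌝v = LC.lam ⌜ M ⌝

  LET : ∀ {n} → Tm n → Tm (suc n) → Tm n
  LET (val V)      P = P [ V ]
  LET (lett V W M) P = lett V W (LET M (ren (ext suc) P))

  infix 4 _⟶_ _⟶v_
  mutual
    data _⟶_ : ∀ {n} → Tm n → Tm n → Set where
      βv    : ∀ {n} {M : Tm (suc n)} {V : Val n} {P : Tm (suc n)} →
              lett (lam M) V P ⟶ LET (M [ V ]) P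
      ξval  : ∀ {n} {V V' : Val n} → V ⟶v V' → val V ⟶ val V'
      ξlet₁ : ∀ {n} {V V' W : Val n} {M : Tm (suc n)} → V ⟶v V' → lett V W M ⟶ lett V' W M
      ξlet₂ : ∀ {n} {V W W' : Val n} {M : Tm (suc n)} → W ⟶v W' → lett V W M ⟶ lett V W' M
      ξlet₃ : ∀ {n} {V W : Val n} {M M' : Tm (suc n)} → M ⟶ M' → lett V W M ⟶ lett V W M'

    data _⟶v_ : ∀ {n} → Val n → Val n → Set where
      ξlam : ∀ {n} {M M' : Tm (suc n)} → M ⟶ M' → lam M ⟶v lam M'

module CNF where
  mutual
    data Tm (n : ℕ) : Set where
      val : Val n → Tm n
      gap : Val n → Val n → Tm (suc n) → Tm n
    data Val (n : ℕ) : Set where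
      var : Fin n → Val n
      lam : Tm (suc n) → Val n

  mutual
    ren : ∀ {n m} → Ren n m → Tm n → Tm m
    ren ρ (val V)     = val (renV ρ V)
    ren ρ (gap V W M) = gap (renV ρ V) (renV ρ W) (ren (ext ρ) M)

    renV : ∀ {n m} → Ren n m → Val n → Val m
    renV ρ (var i) = var (ρ i)
    renV ρ (lam M) = lam (ren (ext ρ) M)

  exts : ∀ {n m} → (Fin n → Val m) → Fin (suc n) → Val (suc m)
  exts σ zero    = var zero
  exts σ (suc i) = renV suc (σ i)

  mutual
    sub : ∀ {n m} → (Fin n → Val m) → Tm n → Tm m
    sub σ (val V)     = val (subV σ V)
    sub σ (gap V W M) = gap (subV σ V) (subV σ W) (sub (exts σ) M)

    subV : ∀ {n m} → (Fin n → Val m) → Val n → Val m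
    subV σ (var i) = σ i
    subV σ (lam M) = lam (sub (exts σ) M)

  sub1 : ∀ {n} → Val n → Fin (suc n) → Val n
  sub1 V zero    = V
  sub1 V (suc i) = var i

  _[_] : ∀ {n} → Tm (suc n) → Val n → Tm n
  N [ V ] = sub (sub1 V) N

  lsub : ∀ {n} → Tm n → Tm (suc n) → Tm n
  lsub (val V)     P = P [ V ]
  lsub (gap V W N) P = gap V W (lsub N (ren (ext suc) P))

  infix 4 _⟶_ _⟶v_
  mutual
    data _⟶_ : ∀ {n} → Tm n → Tm n → Set where
      βv    : ∀ {n} {M : Tm (suc n)} {W : Val n} {P : Tm (suc n)} →
              gap (lam M) W P ⟶ lsub (M [ W ]) P
      ξval  : ∀ {n} {V V' : Val n} → V ⟶v V' → val V ⟶ val V'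
      ξgap₁ : ∀ {n} {V V' W : Val n} {M : Tm (suc n)} → V ⟶v V' → gap V W M ⟶ gap V' W M
      ξgap₂ : ∀ {n} {V W W' : Val n} {M : Tm (suc n)} → W ⟶v W' → gap V W M ⟶ gap V W' M
      ξgap₃ : ∀ {n} {V W : Val n} {M M' : Tm (suc n)} → M ⟶ M' → gap V W M ⟶ gap V W M'

    data _⟶v_ : ∀ {n} → Val n → Val n → Set where
      ξlam : ∀ {n} {M M' : Tm (suc n)} → M ⟶ M' → lam M ⟶v lam M'

  infix 4 _⊢J_∶_ _⊢Jv_∶_
  data _⊢J_∶_ : ∀ {n} → Cxt n → Tm n → Ty → Set
  data _⊢Jv_∶_ : ∀ {n} → Cxt n → Val n → Ty → Set

  data _⊢J_∶_ where
    val : ∀ {n} {Γ : Cxt n} {A V} → Γ ⊢Jv V ∶ A → Γ ⊢J val V ∶ A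
    gap : ∀ {n} {Γ : Cxt n} {A B C V W M} →
          Γ ⊢Jv V ∶ A ⊃ B → Γ ⊢Jv W ∶ A → (B ∷ Γ) ⊢J M ∶ C → Γ ⊢J gap V W M ∶ C

  data _⊢Jv_∶_ where
    var : ∀ {n} {Γ : Cxt n} (i : Fin n) → Γ ⊢Jv var i ∶ lookup Γ i
    lam : ∀ {n} {Γ : Cxt n} {A B M} → (A ∷ Γ) ⊢J M ∶ B → Γ ⊢Jv lam M ∶ A ⊃ B

mutual
  Υ : ∀ {n} → CES.Tm n → CNF.Tm n
  Υ (CES.val V)      = CNF.val (Υv V)
  Υ (CES.lett V W M) = CNF.gap (Υv V) (Υv W) (Υ M)

  Υv : ∀ {n} → CES.Val n → CNF.Val n
  Υv (CES.var i) = CNF.var i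
  Υv (CES.lam M) = CNF.lam (Υ M)

mutual
  Φ : ∀ {n} → CNF.Tm n → CES.Tm n
  Φ (CNF.val V)     = CES.val (Φv V)
  Φ (CNF.gap V W M) = CES.lett (Φv V) (Φv W) (Φ M)

  Φv : ∀ {n} → CNF.Val n → CES.Val n
  Φv (CNF.var i) = CES.var i
  Φv (CNF.lam M) = CES.lam (Φ M)

-- Both isomorphisms are purely notational: Ψ, Θ, Υ and Φ rebuild a term
-- constructor by constructor, so they are mutually inverse by structural
-- induction.  The real content is that they are homomorphisms for the operations
-- the reduction rules are built from: renaming, substitution, and the
-- "append a continuation" operations (LET of VES against the colon of VFS,
-- LET of CES against left substitution in CNF).  Then every redex is sent to a
-- redex of the same rule whose contractum is the image of the original contractum.
-- It suffices to prove these homomorphism laws for Ψ and Υ; for the inverse maps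
-- they follow by conjugating with the bijection.  Typing is preserved and
-- reflected because a VES-term and its λC embedding differ only by weakening
-- renamings, and ⊢C is invariant under well-typed renamings in both directions.
module Submission where

open import Data.Fin using (Fin; zero; suc)
open import Data.Nat using (suc)
open import Data.Product using (_×_; _,_; map; uncurry)
open import Data.Vec using (_∷_; lookup)
open import Function.Base using (_∘_)
open import Function.Bundles using (_⇔_; mk⇔)
open import Relation.Binary.PropositionalEquality
  using (_≡_; refl; sym; cong; cong₂; subst; module ≡-Reasoning)

open import Defs

cong₃ : ∀ {A B C D : Set} (f : A → B → C → D) {a a′ b b′ c c′} →
        a ≡ a′ → b ≡ b′ → c ≡ c′ → f a b c ≡ f a′ b′ c′
cong₃ f refl refl refl = refl

conjugate-≗ : ∀ {A B C D : Set} (f : A → B) (g : B → A) (f′ : C → D) (g′ : D → C)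
              (h : C → A) (k : D → B) →
              (∀ a → g (f a) ≡ a) → (∀ d → f′ (g′ d) ≡ d) →
              (∀ c → f (h c) ≡ k (f′ c)) → ∀ d → g (k d) ≡ h (g′ d)
conjugate-≗ f g f′ g′ h k g∘f f′∘g′ f∘h d = begin
  g (k d)            ≡⟨ cong (g ∘ k) (sym (f′∘g′ d)) ⟩
  g (k (f′ (g′ d)))  ≡⟨ cong g (sym (f∘h (g′ d))) ⟩
  g (f (h (g′ d)))   ≡⟨ g∘f (h (g′ d)) ⟩
  h (g′ d)           ∎
  where open ≡-Reasoning

Θ∘Ψ  : ∀ {n} (M : VES.Tm n) → Θ (Ψ M) ≡ M
Θv∘Ψv : ∀ {n} (V : VES.Val n) → Θv (Ψv V) ≡ V
Θx∘Ψx : ∀ {n} (c : VES.Cx n) → Θx (Ψx c) ≡ c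

Θ∘Ψ (VES.val V)    = cong VES.val (Θv∘Ψv V)
Θ∘Ψ (VES.lett V c) = cong₂ VES.lett (Θv∘Ψv V) (Θx∘Ψx c)

Θv∘Ψv (VES.var i) = refl
Θv∘Ψv (VES.lam M) = cong VES.lam (Θ∘Ψ M)

Θx∘Ψx (VES.tm M)       = cong VES.tm (Θ∘Ψ M)
Θx∘Ψx (VES.letapp W N) = cong₂ VES.letapp (Θv∘Ψv W) (Θ∘Ψ N)

Ψ∘Θ  : ∀ {n} (M : VFS.Tm n) → Ψ (Θ M) ≡ M
Ψv∘Θv : ∀ {n} (V : VFS.Val n) → Ψv (Θv V) ≡ V
Ψx∘Θx : ∀ {n} (c : VFS.Cx n) → Ψx (Θx c) ≡ c

Ψ∘Θ (VFS.up V)   = cong VFS.up (Ψv∘Θv V)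
Ψ∘Θ (VFS.cv V c) = cong₂ VFS.cv (Ψv∘Θv V) (Ψx∘Θx c)

Ψv∘Θv (VFS.var i) = refl
Ψv∘Θv (VFS.lam M) = cong VFS.lam (Ψ∘Θ M)

Ψx∘Θx (VFS.abs M)    = cong VFS.abs (Ψ∘Θ M)
Ψx∘Θx (VFS.pair W N) = cong₂ VFS.pair (Ψv∘Θv W) (Ψ∘Θ N)

Ψ-ren  : ∀ {n m} (ρ : Ren n m) (M : VES.Tm n) → Ψ (VES.ren ρ M) ≡ VFS.ren ρ (Ψ M)
Ψv-ren : ∀ {n m} (ρ : Ren n m) (V : VES.Val n) → Ψv (VES.renV ρ V) ≡ VFS.renV ρ (Ψv V)
Ψx-ren : ∀ {n m} (ρ : Ren n m) (c : VES.Cx n) → Ψx (VES.renC ρ c) ≡ VFS.renC ρ (Ψx c)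

Ψ-ren ρ (VES.val V)    = cong VFS.up (Ψv-ren ρ V)
Ψ-ren ρ (VES.lett V c) = cong₂ VFS.cv (Ψv-ren ρ V) (Ψx-ren ρ c)

Ψv-ren ρ (VES.var i) = refl
Ψv-ren ρ (VES.lam M) = cong VFS.lam (Ψ-ren (ext ρ) M)

Ψx-ren ρ (VES.tm M)       = cong VFS.abs (Ψ-ren (ext ρ) M)
Ψx-ren ρ (VES.letapp W N) = cong₂ VFS.pair (Ψv-ren ρ W) (Ψ-ren (ext ρ) N)

_≈Ψ_ : ∀ {n m} → (Fin n → VES.Val m) → (Fin n → VFS.Val m) → Set
σ ≈Ψ τ = ∀ i → Ψv (σ i) ≡ τ i

≈Ψ-exts : ∀ {n m} {σ : Fin n → VES.Val m} {τ : Fin n → VFS.Val m} →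
          σ ≈Ψ τ → VES.exts σ ≈Ψ VFS.exts τ
≈Ψ-exts σ≈τ zero    = refl
≈Ψ-exts {σ = σ} σ≈τ (suc i) = begin
  Ψv (VES.renV suc (σ i))  ≡⟨ Ψv-ren suc (σ i) ⟩
  VFS.renV suc (Ψv (σ i))  ≡⟨ cong (VFS.renV suc) (σ≈τ i) ⟩
  VFS.renV suc _           ∎
  where open ≡-Reasoning

≈Ψ-sub1 : ∀ {n} (V : VES.Val n) → VES.sub1 V ≈Ψ VFS.sub1 (Ψv V)
≈Ψ-sub1 V zero    = refl
≈Ψ-sub1 V (suc i) = refl

Ψ-sub  : ∀ {n m} {σ : Fin n → VES.Val m} {τ} → σ ≈Ψ τ →
         (M : VES.Tm n) → Ψ (VES.sub σ M) ≡ VFS.sub τ (Ψ M)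
Ψv-sub : ∀ {n m} {σ : Fin n → VES.Val m} {τ} → σ ≈Ψ τ →
         (V : VES.Val n) → Ψv (VES.subV σ V) ≡ VFS.subV τ (Ψv V)
Ψx-sub : ∀ {n m} {σ : Fin n → VES.Val m} {τ} → σ ≈Ψ τ →
         (c : VES.Cx n) → Ψx (VES.subC σ c) ≡ VFS.subC τ (Ψx c)

Ψ-sub σ≈τ (VES.val V)    = cong VFS.up (Ψv-sub σ≈τ V)
Ψ-sub σ≈τ (VES.lett V c) = cong₂ VFS.cv (Ψv-sub σ≈τ V) (Ψx-sub σ≈τ c)

Ψv-sub σ≈τ (VES.var i) = σ≈τ i
Ψv-sub σ≈τ (VES.lam M) = cong VFS.lam (Ψ-sub (≈Ψ-exts σ≈τ) M)

Ψx-sub σ≈τ (VES.tm M)       = cong VFS.abs (Ψ-sub (≈Ψ-exts σ≈τ) M)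
Ψx-sub σ≈τ (VES.letapp W N) = cong₂ VFS.pair (Ψv-sub σ≈τ W) (Ψ-sub (≈Ψ-exts σ≈τ) N)

Ψ-[] : ∀ {n} (N : VES.Tm (suc n)) (V : VES.Val n) → Ψ (N VES.[ V ]) ≡ Ψ N VFS.[ Ψv V ]
Ψ-[] N V = Ψ-sub (≈Ψ-sub1 V) N

Ψ-LET  : ∀ {n} (M : VES.Tm n) (P : VES.Tm (suc n)) →
         Ψ (VES.LET M P) ≡ Ψ M VFS.⦂ VFS.abs (Ψ P)
Ψx-LETc : ∀ {n} (c : VES.Cx n) (P : VES.Tm (suc n)) →
          Ψx (VES.LETc c P) ≡ Ψx c VFS.⦂c VFS.abs (Ψ P)
Ψ-LET-weaken : ∀ {n} (M : VES.Tm (suc n)) (P : VES.Tm (suc n)) →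
               Ψ (VES.LET M (VES.ren (ext suc) P)) ≡
               Ψ M VFS.⦂ VFS.abs (VFS.ren (ext suc) (Ψ P))

Ψ-LET (VES.val V)    P = refl
Ψ-LET (VES.lett V c) P = cong (VFS.cv (Ψv V)) (Ψx-LETc c P)

Ψx-LETc (VES.tm M)       P = cong VFS.abs (Ψ-LET-weaken M P)
Ψx-LETc (VES.letapp W N) P = cong (VFS.pair (Ψv W)) (Ψ-LET-weaken N P)

Ψ-LET-weaken M P = begin
  Ψ (VES.LET M (VES.ren (ext suc) P))            ≡⟨ Ψ-LET M _ ⟩
  Ψ M VFS.⦂ VFS.abs (Ψ (VES.ren (ext suc) P))    ≡⟨ cong (λ Q → Ψ M VFS.⦂ VFS.abs Q) (Ψ-ren (ext suc) P) ⟩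
  Ψ M VFS.⦂ VFS.abs (VFS.ren (ext suc) (Ψ P))    ∎
  where open ≡-Reasoning

Θ-ren : ∀ {n m} (ρ : Ren n m) (M : VFS.Tm n) → Θ (VFS.ren ρ M) ≡ VES.ren ρ (Θ M)
Θ-ren ρ = conjugate-≗ Ψ Θ Ψ Θ (VES.ren ρ) (VFS.ren ρ) Θ∘Ψ Ψ∘Θ (Ψ-ren ρ)

Θ-[] : ∀ {n} (N : VFS.Tm (suc n)) (V : VFS.Val n) → Θ (N VFS.[ V ]) ≡ Θ N VES.[ Θv V ]
Θ-[] N V = conjugate-≗ Ψ Θ (map Ψ Ψv) (map Θ Θv) (uncurry VES._[_]) (uncurry VFS._[_])
  Θ∘Ψ (λ (N , V) → cong₂ _,_ (Ψ∘Θ N) (Ψv∘Θv V)) (uncurry Ψ-[]) (N , V)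

Θ-⦂ : ∀ {n} (M : VFS.Tm n) (Q : VFS.Tm (suc n)) → Θ (M VFS.⦂ VFS.abs Q) ≡ VES.LET (Θ M) (Θ Q)
Θ-⦂ M Q = conjugate-≗ Ψ Θ (map Ψ Ψ) (map Θ Θ)
  (uncurry VES.LET) (uncurry (λ M Q → M VFS.⦂ VFS.abs Q))
  Θ∘Ψ (λ (M , Q) → cong₂ _,_ (Ψ∘Θ M) (Ψ∘Θ Q)) (uncurry Ψ-LET) (M , Q)

Ψ-⟶   : ∀ {n} {M₁ M₂ : VES.Tm n} → M₁ VES.⟶ M₂ → Ψ M₁ VFS.⟶ Ψ M₂
Ψv-⟶v : ∀ {n} {V₁ V₂ : VES.Val n} → V₁ VES.⟶v V₂ → Ψv V₁ VFS.⟶v Ψv V₂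
Ψx-⟶c : ∀ {n} {c₁ c₂ : VES.Cx n} → c₁ VES.⟶c c₂ → Ψx c₁ VFS.⟶c Ψx c₂

Ψ-⟶ (VES.Bv {M = M} {P = P}) rewrite Ψ-LET-weaken M P = VFS.Bv
Ψ-⟶ (VES.letv {V = V} {N})   rewrite Ψ-[] N V          = VFS.σv
Ψ-⟶ (VES.ξval r)  = VFS.ξup (Ψv-⟶v r)
Ψ-⟶ (VES.ξlet₁ r) = VFS.ξcv₁ (Ψv-⟶v r)
Ψ-⟶ (VES.ξlet₂ r) = VFS.ξcv₂ (Ψx-⟶c r)

Ψv-⟶v (VES.ξlam r) = VFS.ξlam (Ψ-⟶ r)

Ψx-⟶c (VES.ξtm r)  = VFS.ξabs (Ψ-⟶ r)
Ψx-⟶c (VES.ξla₁ r) = VFS.ξpair₁ (Ψv-⟶v r)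
Ψx-⟶c (VES.ξla₂ r) = VFS.ξpair₂ (Ψ-⟶ r)

Θ-⟶   : ∀ {n} {M₁ M₂ : VFS.Tm n} → M₁ VFS.⟶ M₂ → Θ M₁ VES.⟶ Θ M₂
Θv-⟶v : ∀ {n} {V₁ V₂ : VFS.Val n} → V₁ VFS.⟶v V₂ → Θv V₁ VES.⟶v Θv V₂
Θx-⟶c : ∀ {n} {c₁ c₂ : VFS.Cx n} → c₁ VFS.⟶c c₂ → Θx c₁ VES.⟶c Θx c₂

Θ-⟶ (VFS.Bv {M = M} {N = N}) rewrite Θ-⦂ M (VFS.ren (ext suc) N) | Θ-ren (ext suc) N = VES.Bv
Θ-⟶ (VFS.σv {V = V} {N})     rewrite Θ-[] N V = VES.letv
Θ-⟶ (VFS.ξup r)  = VES.ξval (Θv-⟶v r)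
Θ-⟶ (VFS.ξcv₁ r) = VES.ξlet₁ (Θv-⟶v r)
Θ-⟶ (VFS.ξcv₂ r) = VES.ξlet₂ (Θx-⟶c r)

Θv-⟶v (VFS.ξlam r) = VES.ξlam (Θ-⟶ r)

Θx-⟶c (VFS.ξabs r)   = VES.ξtm (Θ-⟶ r)
Θx-⟶c (VFS.ξpair₁ r) = VES.ξla₁ (Θv-⟶v r)
Θx-⟶c (VFS.ξpair₂ r) = VES.ξla₂ (Θ-⟶ r)

TypedRen : ∀ {n m} → Ren n m → Cxt n → Cxt m → Set
TypedRen ρ Γ Δ = ∀ i → lookup Δ (ρ i) ≡ lookup Γ i

suc-typed : ∀ {n} {Γ : Cxt n} {A} → TypedRen suc Γ (A ∷ Γ)
suc-typed i = refl

ext-typed : ∀ {n m} {ρ : Ren n m} {Γ Δ A} → TypedRen ρ Γ Δ → TypedRen (ext ρ) (A ∷ Γ) (A ∷ Δ)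
ext-typed ρ-typed zero    = refl
ext-typed ρ-typed (suc i) = ρ-typed i

⊢C-ren : ∀ {n m} {ρ : Ren n m} {Γ Δ M A} →
         TypedRen ρ Γ Δ → Γ LC.⊢C M ∶ A → Δ LC.⊢C LC.ren ρ M ∶ A
⊢C-ren {ρ = ρ} ρ-typed (LC.var i) = subst (_ LC.⊢C LC.var (ρ i) ∶_) (ρ-typed i) (LC.var (ρ i))
⊢C-ren ρ-typed (LC.lam d)    = LC.lam (⊢C-ren (ext-typed ρ-typed) d)
⊢C-ren ρ-typed (LC.app d e)  = LC.app (⊢C-ren ρ-typed d) (⊢C-ren ρ-typed e)
⊢C-ren ρ-typed (LC.lett d e) = LC.lett (⊢C-ren ρ-typed d) (⊢C-ren (ext-typed ρ-typed) e)

⊢C-ren⁻¹ : ∀ {n m} {ρ : Ren n m} {Γ Δ A} (M : LC.Tm n) →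
           TypedRen ρ Γ Δ → Δ LC.⊢C LC.ren ρ M ∶ A → Γ LC.⊢C M ∶ A
⊢C-ren⁻¹ (LC.var i) ρ-typed (LC.var _) = subst (_ LC.⊢C LC.var i ∶_) (sym (ρ-typed i)) (LC.var i)
⊢C-ren⁻¹ (LC.lam M) ρ-typed (LC.lam d) = LC.lam (⊢C-ren⁻¹ M (ext-typed ρ-typed) d)
⊢C-ren⁻¹ (LC.app M N) ρ-typed (LC.app d e) =
  LC.app (⊢C-ren⁻¹ M ρ-typed d) (⊢C-ren⁻¹ N ρ-typed e)
⊢C-ren⁻¹ (LC.lett M N) ρ-typed (LC.lett d e) =
  LC.lett (⊢C-ren⁻¹ M ρ-typed d) (⊢C-ren⁻¹ N (ext-typed ρ-typed) e)

Ψ-preserves-⊢  : ∀ {n} {Γ : Cxt n} (M : VES.Tm n) {A} →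
                 Γ LC.⊢C VES.⌜ M ⌝ ∶ A → Γ VFS.⇒ Ψ M ∶ A
Ψv-preserves-⊢ : ∀ {n} {Γ : Cxt n} (V : VES.Val n) {A} →
                 Γ LC.⊢C VES.⌜ V ⌝v ∶ A → Γ VFS.⊢v Ψv V ∶ A
Ψx-preserves-⊢ : ∀ {n} {Γ : Cxt n} (c : VES.Cx n) {A B} →
                 (A ∷ Γ) LC.⊢C VES.⌜ c ⌝c ∶ B → Γ VFS.∣ A ⇒c Ψx c ∶ B

Ψ-preserves-⊢ (VES.val V) d                = VFS.up (Ψv-preserves-⊢ V d)
Ψ-preserves-⊢ (VES.lett V c) (LC.lett d e) = VFS.cv (Ψv-preserves-⊢ V d) (Ψx-preserves-⊢ c e)

Ψv-preserves-⊢ (VES.var i) (LC.var _) = VFS.var i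
Ψv-preserves-⊢ (VES.lam M) (LC.lam d) = VFS.lam (Ψ-preserves-⊢ M d)

Ψx-preserves-⊢ (VES.tm M) d = VFS.abs (Ψ-preserves-⊢ M d)
Ψx-preserves-⊢ {Γ = Γ} (VES.letapp W N) {A} (LC.lett (LC.app (LC.var zero) e) f) =
  VFS.pair (Ψv-preserves-⊢ W (⊢C-ren⁻¹ VES.⌜ W ⌝v (suc-typed {Γ = Γ} {A}) e))
           (Ψ-preserves-⊢ N (⊢C-ren⁻¹ VES.⌜ N ⌝ (ext-typed (suc-typed {Γ = Γ} {A})) f))

Ψ-reflects-⊢  : ∀ {n} {Γ : Cxt n} (M : VES.Tm n) {A} →
                Γ VFS.⇒ Ψ M ∶ A → Γ LC.⊢C VES.⌜ M ⌝ ∶ A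
Ψv-reflects-⊢ : ∀ {n} {Γ : Cxt n} (V : VES.Val n) {A} →
                Γ VFS.⊢v Ψv V ∶ A → Γ LC.⊢C VES.⌜ V ⌝v ∶ A
Ψx-reflects-⊢ : ∀ {n} {Γ : Cxt n} (c : VES.Cx n) {A B} →
                Γ VFS.∣ A ⇒c Ψx c ∶ B → (A ∷ Γ) LC.⊢C VES.⌜ c ⌝c ∶ B

Ψ-reflects-⊢ (VES.val V) (VFS.up d)      = Ψv-reflects-⊢ V d
Ψ-reflects-⊢ (VES.lett V c) (VFS.cv d e) = LC.lett (Ψv-reflects-⊢ V d) (Ψx-reflects-⊢ c e)

Ψv-reflects-⊢ (VES.var i) (VFS.var _) = LC.var i
Ψv-reflects-⊢ (VES.lam M) (VFS.lam d) = LC.lam (Ψ-reflects-⊢ M d)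

Ψx-reflects-⊢ (VES.tm M) (VFS.abs d) = Ψ-reflects-⊢ M d
Ψx-reflects-⊢ {Γ = Γ} (VES.letapp W N) {A} (VFS.pair d e) =
  LC.lett (LC.app (LC.var zero) (⊢C-ren (suc-typed {Γ = Γ} {A}) (Ψv-reflects-⊢ W d)))
          (⊢C-ren (ext-typed (suc-typed {Γ = Γ} {A})) (Ψ-reflects-⊢ N e))

Φ∘Υ  : ∀ {n} (M : CES.Tm n) → Φ (Υ M) ≡ M
Φv∘Υv : ∀ {n} (V : CES.Val n) → Φv (Υv V) ≡ V

Φ∘Υ (CES.val V)      = cong CES.val (Φv∘Υv V)
Φ∘Υ (CES.lett V W M) = cong₃ CES.lett (Φv∘Υv V) (Φv∘Υv W) (Φ∘Υ M)

Φv∘Υv (CES.var i) = refl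
Φv∘Υv (CES.lam M) = cong CES.lam (Φ∘Υ M)

Υ∘Φ  : ∀ {n} (M : CNF.Tm n) → Υ (Φ M) ≡ M
Υv∘Φv : ∀ {n} (V : CNF.Val n) → Υv (Φv V) ≡ V

Υ∘Φ (CNF.val V)     = cong CNF.val (Υv∘Φv V)
Υ∘Φ (CNF.gap V W M) = cong₃ CNF.gap (Υv∘Φv V) (Υv∘Φv W) (Υ∘Φ M)

Υv∘Φv (CNF.var i) = refl
Υv∘Φv (CNF.lam M) = cong CNF.lam (Υ∘Φ M)

Υ-ren  : ∀ {n m} (ρ : Ren n m) (M : CES.Tm n) → Υ (CES.ren ρ M) ≡ CNF.ren ρ (Υ M)
Υv-ren : ∀ {n m} (ρ : Ren n m) (V : CES.Val n) → Υv (CES.renV ρ V) ≡ CNF.renV ρ (Υv V)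

Υ-ren ρ (CES.val V)      = cong CNF.val (Υv-ren ρ V)
Υ-ren ρ (CES.lett V W M) = cong₃ CNF.gap (Υv-ren ρ V) (Υv-ren ρ W) (Υ-ren (ext ρ) M)

Υv-ren ρ (CES.var i) = refl
Υv-ren ρ (CES.lam M) = cong CNF.lam (Υ-ren (ext ρ) M)

_≈Υ_ : ∀ {n m} → (Fin n → CES.Val m) → (Fin n → CNF.Val m) → Set
σ ≈Υ τ = ∀ i → Υv (σ i) ≡ τ i

≈Υ-exts : ∀ {n m} {σ : Fin n → CES.Val m} {τ : Fin n → CNF.Val m} →
          σ ≈Υ τ → CES.exts σ ≈Υ CNF.exts τ
≈Υ-exts σ≈τ zero    = refl
≈Υ-exts {σ = σ} σ≈τ (suc i) = begin
  Υv (CES.renV suc (σ i))  ≡⟨ Υv-ren suc (σ i) ⟩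
  CNF.renV suc (Υv (σ i))  ≡⟨ cong (CNF.renV suc) (σ≈τ i) ⟩
  CNF.renV suc _           ∎
  where open ≡-Reasoning

≈Υ-sub1 : ∀ {n} (V : CES.Val n) → CES.sub1 V ≈Υ CNF.sub1 (Υv V)
≈Υ-sub1 V zero    = refl
≈Υ-sub1 V (suc i) = refl

Υ-sub  : ∀ {n m} {σ : Fin n → CES.Val m} {τ} → σ ≈Υ τ →
         (M : CES.Tm n) → Υ (CES.sub σ M) ≡ CNF.sub τ (Υ M)
Υv-sub : ∀ {n m} {σ : Fin n → CES.Val m} {τ} → σ ≈Υ τ →
         (V : CES.Val n) → Υv (CES.subV σ V) ≡ CNF.subV τ (Υv V)

Υ-sub σ≈τ (CES.val V)      = cong CNF.val (Υv-sub σ≈τ V)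
Υ-sub σ≈τ (CES.lett V W M) = cong₃ CNF.gap (Υv-sub σ≈τ V) (Υv-sub σ≈τ W) (Υ-sub (≈Υ-exts σ≈τ) M)

Υv-sub σ≈τ (CES.var i) = σ≈τ i
Υv-sub σ≈τ (CES.lam M) = cong CNF.lam (Υ-sub (≈Υ-exts σ≈τ) M)

Υ-[] : ∀ {n} (N : CES.Tm (suc n)) (V : CES.Val n) → Υ (N CES.[ V ]) ≡ Υ N CNF.[ Υv V ]
Υ-[] N V = Υ-sub (≈Υ-sub1 V) N

Υ-LET : ∀ {n} (M : CES.Tm n) (P : CES.Tm (suc n)) → Υ (CES.LET M P) ≡ CNF.lsub (Υ M) (Υ P)
Υ-LET (CES.val V) P = Υ-[] P V
Υ-LET (CES.lett V W M) P = cong (CNF.gap (Υv V) (Υv W)) (begin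
  Υ (CES.LET M (CES.ren (ext suc) P))        ≡⟨ Υ-LET M _ ⟩
  CNF.lsub (Υ M) (Υ (CES.ren (ext suc) P))   ≡⟨ cong (CNF.lsub (Υ M)) (Υ-ren (ext suc) P) ⟩
  CNF.lsub (Υ M) (CNF.ren (ext suc) (Υ P))   ∎)
  where open ≡-Reasoning

Φ-[] : ∀ {n} (N : CNF.Tm (suc n)) (V : CNF.Val n) → Φ (N CNF.[ V ]) ≡ Φ N CES.[ Φv V ]
Φ-[] N V = conjugate-≗ Υ Φ (map Υ Υv) (map Φ Φv) (uncurry CES._[_]) (uncurry CNF._[_])
  Φ∘Υ (λ (N , V) → cong₂ _,_ (Υ∘Φ N) (Υv∘Φv V)) (uncurry Υ-[]) (N , V)

Φ-lsub : ∀ {n} (M : CNF.Tm n) (P : CNF.Tm (suc n)) → Φ (CNF.lsub M P) ≡ CES.LET (Φ M) (Φ P)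
Φ-lsub M P = conjugate-≗ Υ Φ (map Υ Υ) (map Φ Φ) (uncurry CES.LET) (uncurry CNF.lsub)
  Φ∘Υ (λ (M , P) → cong₂ _,_ (Υ∘Φ M) (Υ∘Φ P)) (uncurry Υ-LET) (M , P)

Υ-⟶   : ∀ {n} {M₁ M₂ : CES.Tm n} → M₁ CES.⟶ M₂ → Υ M₁ CNF.⟶ Υ M₂
Υv-⟶v : ∀ {n} {V₁ V₂ : CES.Val n} → V₁ CES.⟶v V₂ → Υv V₁ CNF.⟶v Υv V₂

Υ-⟶ (CES.βv {M = M} {V} {P}) rewrite Υ-LET (M CES.[ V ]) P | Υ-[] M V = CNF.βv
Υ-⟶ (CES.ξval r)  = CNF.ξval (Υv-⟶v r)
Υ-⟶ (CES.ξlet₁ r) = CNF.ξgap₁ (Υv-⟶v r)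
Υ-⟶ (CES.ξlet₂ r) = CNF.ξgap₂ (Υv-⟶v r)
Υ-⟶ (CES.ξlet₃ r) = CNF.ξgap₃ (Υ-⟶ r)

Υv-⟶v (CES.ξlam r) = CNF.ξlam (Υ-⟶ r)

Φ-⟶   : ∀ {n} {M₁ M₂ : CNF.Tm n} → M₁ CNF.⟶ M₂ → Φ M₁ CES.⟶ Φ M₂
Φv-⟶v : ∀ {n} {V₁ V₂ : CNF.Val n} → V₁ CNF.⟶v V₂ → Φv V₁ CES.⟶v Φv V₂

Φ-⟶ (CNF.βv {M = M} {W} {P}) rewrite Φ-lsub (M CNF.[ W ]) P | Φ-[] M W = CES.βv
Φ-⟶ (CNF.ξval r)  = CES.ξval (Φv-⟶v r)
Φ-⟶ (CNF.ξgap₁ r) = CES.ξlet₁ (Φv-⟶v r)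
Φ-⟶ (CNF.ξgap₂ r) = CES.ξlet₂ (Φv-⟶v r)
Φ-⟶ (CNF.ξgap₃ r) = CES.ξlet₃ (Φ-⟶ r)

Φv-⟶v (CNF.ξlam r) = CES.ξlam (Φ-⟶ r)

Υ-preserves-⊢  : ∀ {n} {Γ : Cxt n} (M : CES.Tm n) {A} →
                 Γ LC.⊢C CES.⌜ M ⌝ ∶ A → Γ CNF.⊢J Υ M ∶ A
Υv-preserves-⊢ : ∀ {n} {Γ : Cxt n} (V : CES.Val n) {A} →
                 Γ LC.⊢C CES.⌜ V ⌝v ∶ A → Γ CNF.⊢Jv Υv V ∶ A

Υ-preserves-⊢ (CES.val V) d = CNF.val (Υv-preserves-⊢ V d)
Υ-preserves-⊢ (CES.lett V W M) (LC.lett (LC.app d e) f) =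
  CNF.gap (Υv-preserves-⊢ V d) (Υv-preserves-⊢ W e) (Υ-preserves-⊢ M f)

Υv-preserves-⊢ (CES.var i) (LC.var _) = CNF.var i
Υv-preserves-⊢ (CES.lam M) (LC.lam d) = CNF.lam (Υ-preserves-⊢ M d)

Υ-reflects-⊢  : ∀ {n} {Γ : Cxt n} (M : CES.Tm n) {A} →
                Γ CNF.⊢J Υ M ∶ A → Γ LC.⊢C CES.⌜ M ⌝ ∶ A
Υv-reflects-⊢ : ∀ {n} {Γ : Cxt n} (V : CES.Val n) {A} →
                Γ CNF.⊢Jv Υv V ∶ A → Γ LC.⊢C CES.⌜ V ⌝v ∶ A

Υ-reflects-⊢ (CES.val V) (CNF.val d) = Υv-reflects-⊢ V d
Υ-reflects-⊢ (CES.lett V W M) (CNF.gap d e f) =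
  LC.lett (LC.app (Υv-reflects-⊢ V d) (Υv-reflects-⊢ W e)) (Υ-reflects-⊢ M f)

Υv-reflects-⊢ (CES.var i) (CNF.var _) = LC.var i
Υv-reflects-⊢ (CES.lam M) (CNF.lam d) = LC.lam (Υ-reflects-⊢ M d)

theorem4 :
  -- (a) VES ≅ VFS
  ( (∀ {n} (M : VES.Tm n) → Θ (Ψ M) ≡ M)
  × (∀ {n} (V : VES.Val n) → Θv (Ψv V) ≡ V)
  × (∀ {n} (M : VFS.Tm n) → Ψ (Θ M) ≡ M)
  × (∀ {n} (V : VFS.Val n) → Ψv (Θv V) ≡ V)
  × (∀ {n} {M₁ M₂ : VES.Tm n} → M₁ VES.⟶ M₂ → Ψ M₁ VFS.⟶ Ψ M₂)
  × (∀ {n} {M₁ M₂ : VFS.Tm n} → M₁ VFS.⟶ M₂ → Θ M₁ VES.⟶ Θ M₂)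
  × (∀ {n} (Γ : Cxt n) (M : VES.Tm n) (A : Ty) →
       (Γ LC.⊢C VES.⌜ M ⌝ ∶ A) ⇔ (Γ VFS.⇒ Ψ M ∶ A)) )
  ×
  -- (b) CES ≅ CNF
  ( (∀ {n} (M : CES.Tm n) → Φ (Υ M) ≡ M)
  × (∀ {n} (V : CES.Val n) → Φv (Υv V) ≡ V)
  × (∀ {n} (M : CNF.Tm n) → Υ (Φ M) ≡ M)
  × (∀ {n} (V : CNF.Val n) → Υv (Φv V) ≡ V)
  × (∀ {n} {M₁ M₂ : CES.Tm n} → M₁ CES.⟶ M₂ → Υ M₁ CNF.⟶ Υ M₂)
  × (∀ {n} {M₁ M₂ : CNF.Tm n} → M₁ CNF.⟶ M₂ → Φ M₁ CES.⟶ Φ M₂)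
  × (∀ {n} (Γ : Cxt n) (M : CES.Tm n) (A : Ty) →
       (Γ LC.⊢C CES.⌜ M ⌝ ∶ A) ⇔ (Γ CNF.⊢J Υ M ∶ A)) )
theorem4 =
  ( Θ∘Ψ , Θv∘Ψv , Ψ∘Θ , Ψv∘Θv , Ψ-⟶ , Θ-⟶
  , λ Γ M A → mk⇔ (Ψ-preserves-⊢ M) (Ψ-reflects-⊢ M) )
  , ( Φ∘Υ , Φv∘Υv , Υ∘Φ , Υv∘Φv , Υ-⟶ , Φ-⟶
  , λ Γ M A → mk⇔ (Υ-preserves-⊢ M) (Υ-reflects-⊢ M) )
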